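{- For all integers $n\ge 1$, $k\ge 0$ and $p$, $$N_E(n,k,p)=\frac{n}{k+1}\,N_k^{n,p}.$$
   Context: A lattice path of length $n$ here is a path in the plane starting at the origin $(0,0)$ and consisting of $n$ unit steps, each either E $=(1,0)$ or N $=(0,1)$. For integers $n\ge 1$, $k\ge 0$, $r$, $s$, let $M_{r,s}^{n,k}$ be the number of ordered pairs of lattice paths of length $n$ such that the first path ends at $(r,n-r)$, the second path ends at $(s,n-s)$, and the two paths intersect exactly $k$ times, where intersections at the origin and at the endpoints of the paths are not counted; that is, there are exactly $k$ indices $m$ with $1\le m\le n-1$ such that the two paths are at the same lattice point after $m$ steps. ($M_{r,s}^{n,k}=0$ unless $0\le r,s\le n$.) Put $N_k^{n,r}=M_{r,r}^{n,k}$. For an integer $p$ define $$N_E(n,k,p)=\sum_{r+s=2p} M_{r,s}^{n,k},$$ where the sum is over all ordered pairs of integers $(r,s)$ with $0\le r,s\le n$ and $r+s=2p$. -}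

module Defs where

open import Data.Fin using (Fin; zero; suc; toℕ; fromℕ)
open import Data.Integer as ℤ using (ℤ; +_; 0ℤ; 1ℤ)
import Data.Integer.Properties as ℤ
open import Data.List using (List; []; _∷_; [_]; allFin; cartesianProduct; cartesianProductWith; filter; length; map; upTo)
open import Data.List.Membership.Propositional using (_∈_)
open import Data.List.Membership.Propositional.Properties using (∈-cartesianProductWith⁺)
open import Data.List.Relation.Unary.All using ([]; _∷_)
open import Data.List.Relation.Unary.AllPairs using ([]; _∷_)
open import Data.List.Relation.Unary.Any using (here; there)
open import Data.List.Relation.Unary.Unique.Propositional using (Unique)
open import Data.List.Relation.Unary.Unique.Propositional.Properties using (cartesianProductWith⁺)
open import Data.Nat as ℕ using (ℕ; zero; suc; _≤_; _<_)
open import Data.Nat.ListAction using (sum)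
import Data.Nat.Properties as ℕ
open import Data.Product using (_×_; _,_)
open import Data.Product.Properties using (≡-dec)
open import Data.Vec using (Vec; []; _∷_)
open import Data.Vec.Properties using (∷-injective)
open import Relation.Binary using (DecidableEquality)
open import Relation.Binary.PropositionalEquality using (_≡_; refl)
open import Relation.Nullary using (Dec; _×-dec_)

Point : Set
Point = ℤ × ℤ

_≟ᴾ_ : DecidableEquality Point
_≟ᴾ_ = ≡-dec ℤ._≟_ ℤ._≟_

origin : Point
origin = 0ℤ , 0ℤ

data Step : Set where
  E N : Step

move : Step → Point → Point
move E (x , y) = x ℤ.+ 1ℤ , y
move N (x , y) = x , y ℤ.+ 1ℤ

Path : ℕ → Set
Path n = Vec Step n

pointFrom : ∀ {n} → Point → Path n → Fin (suc n) → Point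
pointFrom a p       zero    = a
pointFrom a (s ∷ p) (suc m) = pointFrom (move s a) p m

pointAfter : ∀ {n} → Path n → Fin (suc n) → Point
pointAfter = pointFrom origin

endpoint : ∀ {n} → Path n → Point
endpoint {n} p = pointAfter p (fromℕ n)

Intersect : ∀ {n} → Path n → Path n → Fin (suc n) → Set
Intersect {n} p q m = 1 ≤ toℕ m × toℕ m < n × pointAfter p m ≡ pointAfter q m

intersect? : ∀ {n} (p q : Path n) (m : Fin (suc n)) → Dec (Intersect p q m)
intersect? {n} p q m =
  (1 ℕ.≤? toℕ m) ×-dec (toℕ m ℕ.<? n) ×-dec (pointAfter p m ≟ᴾ pointAfter q m)

#intersections : ∀ {n} → Path n → Path n → ℕ
#intersections {n} p q = length (filter (intersect? p q) (allFin (suc n)))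

steps : List Step
steps = E ∷ N ∷ []

paths : ∀ n → List (Path n)
paths zero    = [ [] ]
paths (suc n) = cartesianProductWith _∷_ steps (paths n)

-- Every path occurs in `paths n` exactly once, so that filtering
-- `cartesianProduct (paths n) (paths n)` and taking lengths counts
-- ordered pairs of paths.

paths-complete : ∀ {n} (p : Path n) → p ∈ paths n
paths-complete []      = here refl
paths-complete (s ∷ p) = ∈-cartesianProductWith⁺ _∷_ (s∈steps s) (paths-complete p)
  where
  s∈steps : ∀ s → s ∈ steps
  s∈steps E = here refl
  s∈steps N = there (here refl)

paths-unique : ∀ n → Unique (paths n)
paths-unique zero    = [] ∷ []
paths-unique (suc n) =
  cartesianProductWith⁺ _∷_ ∷-injective (((λ ()) ∷ []) ∷ [] ∷ []) (paths-unique n)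

Counted : (n k : ℕ) (r s : ℤ) → Path n × Path n → Set
Counted n k r s (p , q) =
  endpoint p ≡ (r , + n ℤ.- r) × endpoint q ≡ (s , + n ℤ.- s) × #intersections p q ≡ k

counted? : ∀ n k r s (pq : Path n × Path n) → Dec (Counted n k r s pq)
counted? n k r s (p , q) =
  (endpoint p ≟ᴾ (r , + n ℤ.- r)) ×-dec
  (endpoint q ≟ᴾ (s , + n ℤ.- s)) ×-dec
  (#intersections p q ℕ.≟ k)

M : (n k : ℕ) (r s : ℤ) → ℕ
M n k r s = length (filter (counted? n k r s) (cartesianProduct (paths n) (paths n)))

Nₖ : (n k : ℕ) (r : ℤ) → ℕ
Nₖ n k r = M n k r r

integersUpTo : ℕ → List ℤ
integersUpTo n = map +_ (upTo (suc n))

indexPairs : ℕ → ℤ → List (ℤ × ℤ)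
indexPairs n p =
  filter (λ (r , s) → r ℤ.+ s ℤ.≟ + 2 ℤ.* p)
         (cartesianProduct (integersUpTo n) (integersUpTo n))

N-E : (n k : ℕ) (p : ℤ) → ℕ
N-E n k p = sum (map (λ (r , s) → M n k r s) (indexPairs n p))

{-# OPTIONS --safe #-}
-- Record a pair of paths by the difference d of its two E-counts, with x marking
-- every E step: d is a walk with step weights x (up), 1 + x² (stay) and x (down).
-- Let F be the length series of the walks whose first return to 0 is at the end,
-- so that bridges with k interior zeros have series F^(k+1).  By the
-- decomposition at the zeros, the identity follows from the Leibniz rule for
-- θ = z d/dz once it is known for k = 0: walks of length n without interior zeros
-- that end at an even height number n times the excursions counted by F.
-- That case holds because a positive walk to height 2h, cut at its last visit to h,
-- becomes (after time reversal of the second part) a positive excursion marked at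
-- an interior time, where it has height h.

module Submission where

open import Algebra.Bundles using (CommutativeMonoid; CommutativeSemiring)
open import Data.Bool using (Bool; true; false; if_then_else_; _∧_)
open import Data.Nat using (ℕ; zero; suc; _≤_; _<_; z≤n; s≤s; _≡ᵇ_; _<ᵇ_)
import Data.Nat as ℕ
import Data.Nat.Properties as ℕ
open import Relation.Binary.PropositionalEquality as ≡ using (_≡_)

-- Antidiagonal sums and the semiring of formal power series.

module Convolution {c ℓ} (R : CommutativeSemiring c ℓ) where
  open CommutativeSemiring R
  open import Algebra.Construct.Pointwise ℕ using () renaming (commutativeMonoid to pointwise)
  open import Algebra.Bundles using (CommutativeMonoid)
  open import Algebra.Properties.CommutativeMonoid.Mult +-commutativeMonoid
    using (_×_; ×-distrib-+)
  open import Algebra.Properties.CommutativeSemigroup +-commutativeSemigroup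
    using (interchange)
  open import Relation.Binary.Reasoning.Setoid setoid

  ⟦_⟧ : Bool → Carrier
  ⟦ b ⟧ = if b then 1# else 0#

  diag : (ℕ → ℕ → Carrier) → ℕ → Carrier
  diag φ zero    = φ 0 0
  diag φ (suc n) = φ 0 (suc n) + diag (λ i → φ (suc i)) n

  diag-cong-on : ∀ {φ ψ} n → (∀ i j → i ℕ.+ j ≡ n → φ i j ≈ ψ i j) → diag φ n ≈ diag ψ n
  diag-cong-on zero    eq = eq 0 0 ≡.refl
  diag-cong-on (suc n) eq =
    +-cong (eq 0 (suc n) ≡.refl) (diag-cong-on n λ i j i+j → eq (suc i) j (≡.cong suc i+j))

  diag-cong : ∀ {φ ψ} → (∀ i j → φ i j ≈ ψ i j) → ∀ n → diag φ n ≈ diag ψ n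
  diag-cong eq n = diag-cong-on n λ i j _ → eq i j

  diag-0 : ∀ n → diag (λ _ _ → 0#) n ≈ 0#
  diag-0 zero    = refl
  diag-0 (suc n) = trans (+-identityˡ _) (diag-0 n)

  diag-+ : ∀ φ ψ n → diag (λ i j → φ i j + ψ i j) n ≈ diag φ n + diag ψ n
  diag-+ φ ψ zero    = refl
  diag-+ φ ψ (suc n) = trans (+-congˡ (diag-+ _ _ n)) (interchange _ _ _ _)

  diag-*ˡ : ∀ a φ n → diag (λ i j → a * φ i j) n ≈ a * diag φ n
  diag-*ˡ a φ zero    = refl
  diag-*ˡ a φ (suc n) = trans (+-congˡ (diag-*ˡ a _ n)) (sym (distribˡ _ _ _))

  diag-*ʳ : ∀ a φ n → diag (λ i j → φ i j * a) n ≈ diag φ n * a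
  diag-*ʳ a φ zero    = refl
  diag-*ʳ a φ (suc n) = trans (+-congˡ (diag-*ʳ a _ n)) (sym (distribʳ _ _ _))

  diag-× : ∀ m φ n → diag (λ i j → m × φ i j) n ≈ m × diag φ n
  diag-× m φ zero    = refl
  diag-× m φ (suc n) = trans (+-congˡ (diag-× m _ n)) (sym (×-distrib-+ _ _ m))

  diag-last : ∀ φ n → diag φ (suc n) ≈ diag (λ i j → φ i (suc j)) n + φ (suc n) 0
  diag-last φ zero    = refl
  diag-last φ (suc n) = trans (+-congˡ (diag-last (λ i → φ (suc i)) n)) (sym (+-assoc _ _ _))

  diag-flip : ∀ φ n → diag φ n ≈ diag (λ i j → φ j i) n
  diag-flip φ zero    = refl
  diag-flip φ (suc n) = begin
    φ 0 (suc n) + diag (λ i → φ (suc i)) n         ≈⟨ +-congˡ (diag-flip _ n) ⟩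
    φ 0 (suc n) + diag (λ i j → φ (suc j) i) n     ≈⟨ +-comm _ _ ⟩
    diag (λ i j → φ (suc j) i) n + φ 0 (suc n)     ≈⟨ diag-last (λ i j → φ j i) n ⟨
    diag (λ i j → φ j i) (suc n)                   ∎

  -- Both sides run over the triples with sum n; the induction splits off those with h = 0.
  diag-assoc : ∀ (φ : ℕ → ℕ → ℕ → Carrier) n →
    diag (λ m j → diag (λ h i → φ h i j) m) n ≈ diag (λ h m → diag (φ h) m) n
  diag-assoc φ zero    = refl
  diag-assoc φ (suc n) = begin
    φ 0 0 (suc n) + diag (λ m j → φ 0 (suc m) j + diag (λ h i → φ (suc h) i j) m) n
      ≈⟨ +-congˡ (diag-+ _ _ n) ⟩
    φ 0 0 (suc n) + (diag (λ m j → φ 0 (suc m) j) n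
                     + diag (λ m j → diag (λ h i → φ (suc h) i j) m) n)
      ≈⟨ +-assoc _ _ _ ⟨
    diag (φ 0) (suc n) + diag (λ m j → diag (λ h i → φ (suc h) i j) m) n
      ≈⟨ +-congˡ (diag-assoc (λ h → φ (suc h)) n) ⟩
    diag (φ 0) (suc n) + diag (λ h m → diag (φ (suc h)) m) n ∎

  Series : Set c
  Series = ℕ → Carrier

  infixl 7 _⊛_
  _⊛_ : Series → Series → Series
  (f ⊛ g) n = diag (λ i j → f i * g j) n

  one : Series
  one zero    = 1#
  one (suc _) = 0#

  ⊛-cong : ∀ {f g h k} → (∀ n → f n ≈ g n) → (∀ n → h n ≈ k n) → ∀ n → (f ⊛ h) n ≈ (g ⊛ k) n
  ⊛-cong f≈g h≈k = diag-cong λ i j → *-cong (f≈g i) (h≈k j)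

  ⊛-comm : ∀ f g n → (f ⊛ g) n ≈ (g ⊛ f) n
  ⊛-comm f g n = trans (diag-flip _ n) (diag-cong (λ i j → *-comm _ _) n)

  ⊛-assoc : ∀ f g h n → ((f ⊛ g) ⊛ h) n ≈ (f ⊛ (g ⊛ h)) n
  ⊛-assoc f g h n = begin
    diag (λ m k → diag (λ i j → f i * g j) m * h k) n    ≈⟨ diag-cong (λ m k → diag-*ʳ (h k) _ m) n ⟨
    diag (λ m k → diag (λ i j → f i * g j * h k) m) n    ≈⟨ diag-assoc (λ i j k → f i * g j * h k) n ⟩
    diag (λ i m → diag (λ j k → f i * g j * h k) m) n
      ≈⟨ diag-cong (λ i m → trans (diag-cong (λ j k → *-assoc _ _ _) m) (diag-*ˡ (f i) _ m)) n ⟩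
    diag (λ i m → f i * diag (λ j k → g j * h k) m) n    ∎

  ⊛-distribʳ : ∀ f g h n → ((λ m → g m + h m) ⊛ f) n ≈ (g ⊛ f) n + (h ⊛ f) n
  ⊛-distribʳ f g h n = trans (diag-cong (λ i j → distribʳ _ _ _) n) (diag-+ _ _ n)

  ⊛-zeroˡ : ∀ f n → ((λ _ → 0#) ⊛ f) n ≈ 0#
  ⊛-zeroˡ f n = trans (diag-cong (λ i j → zeroˡ _) n) (diag-0 n)

  ⊛-identityˡ : ∀ f n → (one ⊛ f) n ≈ f n
  ⊛-identityˡ f zero    = *-identityˡ _
  ⊛-identityˡ f (suc n) =
    trans (+-cong (*-identityˡ _) (⊛-zeroˡ f n)) (+-identityʳ _)

  ⊛-shiftˡ : ∀ f g n → f 0 ≈ 0# → (f ⊛ g) (suc n) ≈ ((λ i → f (suc i)) ⊛ g) n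
  ⊛-shiftˡ f g n f0≈0 = trans (+-congʳ (trans (*-congʳ f0≈0) (zeroˡ _))) (+-identityˡ _)

  -- Needed at two levels: over ℕ it supplies the series in `X` that serve as step weights, and over
  -- these the series in the length of a walk.
  seriesSemiring : CommutativeSemiring c ℓ
  seriesSemiring = record
    { isCommutativeSemiring = isCommutativeSemiringˡ record
      { +-isCommutativeMonoid = CommutativeMonoid.isCommutativeMonoid (pointwise +-commutativeMonoid)
      ; *-isCommutativeMonoid = isCommutativeMonoidˡ record
        { isSemigroup = record
          { isMagma = record
            { isEquivalence = CommutativeMonoid.isEquivalence (pointwise +-commutativeMonoid)
            ; ∙-cong = ⊛-cong }
          ; assoc = ⊛-assoc }
        ; identityˡ = ⊛-identityˡ
        ; comm = ⊛-comm }
      ; distribʳ = ⊛-distribʳ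
      ; zeroˡ = ⊛-zeroˡ
      } }
    where open import Algebra.Structures.Biased

  θ : Series → Series
  θ f n = n × f n

-- Zero, parity and doubling.

isZero isEven : ℕ → Bool
isZero zero    = true
isZero (suc _) = false
isEven zero          = true
isEven (suc zero)    = false
isEven (suc (suc d)) = isEven d

double : ℕ → ℕ
double zero    = 0
double (suc h) = suc (suc (double h))

double≡ : ∀ h → double h ≡ h ℕ.+ h
double≡ zero    = ≡.refl
double≡ (suc h) = ≡.cong suc (≡.trans (≡.cong suc (double≡ h)) (≡.sym (ℕ.+-suc h h)))

isEven-double : ∀ h → isEven (double h) ≡ true
isEven-double zero    = ≡.refl
isEven-double (suc h) = isEven-double h

isEven-suc-double : ∀ h → isEven (suc (double h)) ≡ false
isEven-suc-double zero    = ≡.refl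
isEven-suc-double (suc h) = isEven-suc-double h

-- Weighted walks and first passage, with an arbitrary weight s for level steps.

module Walks {c ℓ} (R : CommutativeSemiring c ℓ) (x s : CommutativeSemiring.Carrier R) where
  open CommutativeSemiring R
  open Convolution R
  private module S = CommutativeSemiring seriesSemiring
  open import Algebra.Properties.Semiring.Mult semiring
    using (_×_; ×-congʳ; ×-homo-+; ×-assoc-*; ×-comm-*; ×-homo-1)
  open import Algebra.Properties.CommutativeMonoid.Mult +-commutativeMonoid using (×-distrib-+)
  open import Algebra.Properties.CommutativeSemigroup +-commutativeSemigroup
    using (interchange)
  open import Algebra.Properties.CommutativeSemigroup S.*-commutativeSemigroup
    using (x∙yz≈y∙xz)
  open import Algebra.Solver.Ring.NaturalCoefficients.Default R using (solve; _:=_; _:+_; _:*_; con)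
  open import Relation.Binary.Reasoning.Setoid setoid

  -- On the antidiagonal i + j = n, the n copies of a product split into i copies charged to f and j
  -- copies charged to g.
  θ-⊛ : ∀ f g n → θ (f ⊛ g) n ≈ (θ f ⊛ g) n + (f ⊛ θ g) n
  θ-⊛ f g n = begin
    n × diag (λ i j → f i * g j) n                             ≈⟨ diag-× n _ n ⟨
    diag (λ i j → n × (f i * g j)) n                           ≈⟨ diag-cong-on n leibniz ⟩
    diag (λ i j → (i × f i) * g j + f i * (j × g j)) n         ≈⟨ diag-+ _ _ n ⟩
    (θ f ⊛ g) n + (f ⊛ θ g) n                                  ∎
    where
    leibniz : ∀ i j → i ℕ.+ j ≡ n → n × (f i * g j) ≈ (i × f i) * g j + f i * (j × g j)
    leibniz i j ≡.refl = trans (×-homo-+ _ i j)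
      (+-cong (sym (×-assoc-* i _ _)) (sym (×-comm-* j _ _)))

  ⊛-scaleˡ : ∀ a f g n → ((λ i → a * f i) ⊛ g) n ≈ a * (f ⊛ g) n
  ⊛-scaleˡ a f g n = trans (diag-cong (λ i j → *-assoc _ _ _) n) (diag-*ˡ a _ n)

  -- Total weight of the n-step walks that start at absolute height d, are at 0 at
  -- exactly k of the times 0, …, n-1 (not n), and end at a height accepted by u.
  T : (ℕ → Bool) → (n d k : ℕ) → Carrier
  T u zero    d       zero    = ⟦ u d ⟧
  T u zero    d       (suc k) = 0#
  T u (suc n) zero    zero    = 0#
  T u (suc n) zero    (suc k) = s * T u n 0 k + (x + x) * T u n 1 k
  T u (suc n) (suc d) k       = x * T u n d k + s * T u n (suc d) k + x * T u n (suc (suc d)) k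

  -- With k = 0 the walk avoids 0 before its final time. So `P d` is the first-passage series from d
  -- to 0, while `Q d` admits every even end height, 0 included.
  P Q : ℕ → Series
  P d n = T isZero n d 0
  Q d n = T isEven n d 0

  -- Starting at 0 uses up one of the suc k zeros, so k counts the interior ones;
  -- the walk of length 0 contributes nothing.
  V : (ℕ → Bool) → ℕ → Series
  V u k n = T u n 0 (suc k)

  F : Series
  F = V isZero 0

  -- A discrete heat equation with time n. The boundary row `H 0` is left free, so `P`, `Q` and
  -- every `T u _ _ k` satisfy it by `refl`.
  Harmonic : (ℕ → Series) → Set ℓ
  Harmonic H = ∀ d n → H (suc d) (suc n) ≈ x * H d n + s * H (suc d) n + x * H (suc (suc d)) n

  P₀≈one : ∀ n → P 0 n ≈ one n
  P₀≈one zero    = refl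
  P₀≈one (suc n) = refl

  P₀⊛ : ∀ f n → (P 0 ⊛ f) n ≈ f n
  P₀⊛ f n = trans (⊛-cong {h = f} P₀≈one (λ _ → refl) n) (⊛-identityˡ f n)

  -- Since H starts from zero at positive heights, all its weight comes from the boundary: a walk
  -- from d is cut at its first arrival at 0, and `H 0` weighs the rest.
  firstPassage : ∀ {H} → Harmonic H → (∀ d → H (suc d) 0 ≈ 0#) →
    ∀ n d → H d n ≈ (P d ⊛ H 0) n
  firstPassage {H} harm H0 n       zero    = sym (P₀⊛ (H 0) n)
  firstPassage {H} harm H0 zero    (suc d) = trans (H0 d) (sym (zeroˡ _))
  firstPassage {H} harm H0 (suc n) (suc d) = begin
    H (suc d) (suc n)
      ≈⟨ harm d n ⟩
    x * H d n + s * H (suc d) n + x * H (suc (suc d)) n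
      ≈⟨ +-cong (+-cong (term x d) (term s (suc d))) (term x (suc (suc d))) ⟩
    (xP d ⊛ H 0) n + (sP ⊛ H 0) n + (xP (suc (suc d)) ⊛ H 0) n
      ≈⟨ +-congʳ (⊛-distribʳ (H 0) (xP d) sP n) ⟨
    ((λ i → xP d i + sP i) ⊛ H 0) n + (xP (suc (suc d)) ⊛ H 0) n
      ≈⟨ ⊛-distribʳ (H 0) _ (xP (suc (suc d))) n ⟨
    ((λ i → P (suc d) (suc i)) ⊛ H 0) n
      ≈⟨ ⊛-shiftˡ (P (suc d)) (H 0) n refl ⟨
    (P (suc d) ⊛ H 0) (suc n) ∎
    where
    xP : ℕ → Series
    xP e i = x * P e i
    sP : Series
    sP i = s * P (suc d) i
    term : ∀ a e → a * H e n ≈ ((λ i → a * P e i) ⊛ H 0) n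
    term a e = trans (*-congˡ (firstPassage harm H0 n e)) (sym (⊛-scaleˡ a (P e) (H 0) n))

  -- The walk is cut at its first interior zero. The part before it is counted by `F`; the part
  -- after it starts at a zero and has one interior zero fewer.
  V-suc : ∀ u k n → V u (suc k) n ≈ (F ⊛ V u k) n
  V-suc u k zero    = sym (zeroˡ _)
  V-suc u k (suc n) = begin
    s * V u k n + (x + x) * T u n 1 (suc k)
      -- A level first step returns to 0 at once. Inserting the unit `P 0` gives this case the same
      -- shape as the others, and together they form the first-step recursion of `F`.
      ≈⟨ +-cong (*-congˡ (sym (P₀⊛ (V u k) n)))
                (*-congˡ (firstPassage {λ d n → T u n d (suc k)} (λ _ _ → refl) (λ _ → refl) n 1)) ⟩
    s * (P 0 ⊛ V u k) n + (x + x) * (P 1 ⊛ V u k) n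
      ≈⟨ +-cong (⊛-scaleˡ s (P 0) (V u k) n) (⊛-scaleˡ (x + x) (P 1) (V u k) n) ⟨
    ((λ i → s * P 0 i) ⊛ V u k) n + ((λ i → (x + x) * P 1 i) ⊛ V u k) n
      ≈⟨ ⊛-distribʳ (V u k) _ _ n ⟨
    ((λ i → F (suc i)) ⊛ V u k) n
      ≈⟨ ⊛-shiftˡ F (V u k) n refl ⟨
    (F ⊛ V u k) (suc n) ∎

  -- Heights change by at most one per step, so a descent from a + b to 0 meets b. Formally,
  -- `firstPassage` is applied with height b as the boundary.
  P-convolution : ∀ a b n → P (a ℕ.+ b) n ≈ (P a ⊛ P b) n
  P-convolution a b n = firstPassage {λ d → P (d ℕ.+ b)} (λ _ _ → refl) (λ _ → refl) n a

  -- A descent from d takes at least d steps. This is what allows sums over heights to be truncated.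
  P-vanishes : ∀ {d n} → n < d → P d n ≈ 0#
  P-vanishes {suc d} {zero}  _         = refl
  P-vanishes {suc d} {suc n} (s≤s n<d) = begin
    x * P d n + s * P (suc d) n + x * P (suc (suc d)) n
      ≈⟨ +-cong (+-cong (*-congˡ (P-vanishes n<d)) (*-congˡ (P-vanishes (ℕ.m≤n⇒m≤1+n n<d))))
                (*-congˡ (P-vanishes (ℕ.m≤n⇒m≤1+n (ℕ.m≤n⇒m≤1+n n<d)))) ⟩
    x * 0# + s * 0# + x * 0#
      ≈⟨ solve 2 (λ x s → x :* con 0 :+ s :* con 0 :+ x :* con 0 := con 0) refl x s ⟩
    0# ∎

  -- Sums over heights, Green's identity and time reversal.

  -- The sum runs over 1 ≤ d ≤ N.
  ∑ : ℕ → (ℕ → Carrier) → Carrier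
  ∑ zero    f = 0#
  ∑ (suc N) f = ∑ N f + f (suc N)

  ∑-cong : ∀ N {f g} → (∀ d → f (suc d) ≈ g (suc d)) → ∑ N f ≈ ∑ N g
  ∑-cong zero    eq = refl
  ∑-cong (suc N) eq = +-cong (∑-cong N eq) (eq N)

  ∑-0 : ∀ N {f} → (∀ d → f (suc d) ≈ 0#) → ∑ N f ≈ 0#
  ∑-0 zero    eq = refl
  ∑-0 (suc N) eq = trans (+-cong (∑-0 N eq) (eq N)) (+-identityʳ _)

  ∑-+ : ∀ N f g → ∑ N (λ d → f d + g d) ≈ ∑ N f + ∑ N g
  ∑-+ zero    f g = sym (+-identityʳ _)
  ∑-+ (suc N) f g = trans (+-congʳ (∑-+ N f g)) (interchange _ _ _ _)

  ∑-diag : ∀ N (φ : ℕ → ℕ → ℕ → Carrier) n →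
    ∑ N (λ d → diag (φ d) n) ≈ diag (λ i j → ∑ N (λ d → φ d i j)) n
  ∑-diag N φ zero    = refl
  ∑-diag N φ (suc n) = trans (∑-+ N _ _) (+-congˡ (∑-diag N (λ d i → φ d (suc i)) n))

  ∑-head : ∀ N {f} → (∀ d → f (suc (suc d)) ≈ 0#) → ∑ (suc N) f ≈ f 1
  ∑-head zero    eq = +-identityˡ _
  ∑-head (suc N) eq = trans (+-cong (∑-head N eq) (eq N)) (+-identityʳ _)

  -- Discrete Green identity: the step operator is self-adjoint up to boundary terms.
  green : ∀ {G H} → Harmonic G → Harmonic H → ∀ i j N →
    ∑ N (λ d → G d i * H d (suc j)) + x * (G 0 i * H 1 j) + x * (G (suc N) i * H N j)
    ≈ ∑ N (λ d → G d (suc i) * H d j) + x * (G 1 i * H 0 j) + x * (G N i * H (suc N) j)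
  green {G} {H} harmG harmH i j zero =
    solve 3 (λ x a b → con 0 :+ x :* a :+ x :* b := con 0 :+ x :* b :+ x :* a) refl x _ _
  green {G} {H} harmG harmH i j (suc N) = begin
    A + g₁ * H (suc N) (suc j) + a + x * (g₂ * h₁)
      ≈⟨ +-congʳ (+-congʳ (+-congˡ (*-congˡ (harmH N j)))) ⟩
    A + g₁ * (x * h₀ + s * h₁ + x * h₂) + a + x * (g₂ * h₁)
      ≈⟨ solve 9 (λ x s A a g₁ g₂ h₀ h₁ h₂ →
           A :+ g₁ :* (x :* h₀ :+ s :* h₁ :+ x :* h₂) :+ a :+ x :* (g₂ :* h₁)
           := (A :+ a :+ x :* (g₁ :* h₀)) :+ (s :* (g₁ :* h₁) :+ x :* (g₁ :* h₂) :+ x :* (g₂ :* h₁)))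
         refl x s A a g₁ g₂ h₀ h₁ h₂ ⟩
    A + a + x * (g₁ * h₀) + (s * (g₁ * h₁) + x * (g₁ * h₂) + x * (g₂ * h₁))
      ≈⟨ +-congʳ (green harmG harmH i j N) ⟩
    B + b + x * (g₀ * h₁) + (s * (g₁ * h₁) + x * (g₁ * h₂) + x * (g₂ * h₁))
      ≈⟨ solve 9 (λ x s B b g₀ g₁ g₂ h₁ h₂ →
           (B :+ b :+ x :* (g₀ :* h₁)) :+ (s :* (g₁ :* h₁) :+ x :* (g₁ :* h₂) :+ x :* (g₂ :* h₁))
           := B :+ (x :* g₀ :+ s :* g₁ :+ x :* g₂) :* h₁ :+ b :+ x :* (g₁ :* h₂))
         refl x s B b g₀ g₁ g₂ h₁ h₂ ⟩
    B + (x * g₀ + s * g₁ + x * g₂) * h₁ + b + x * (g₁ * h₂)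
      ≈⟨ +-congʳ (+-congʳ (+-congˡ (*-congʳ (harmG N i)))) ⟨
    B + G (suc N) (suc i) * h₁ + b + x * (g₁ * h₂) ∎
    where
    A = ∑ N (λ d → G d i * H d (suc j))
    B = ∑ N (λ d → G d (suc i) * H d j)
    a = x * (G 0 i * H 1 j)
    b = x * (G 1 i * H 0 j)
    g₀ = G N i
    g₁ = G (suc N) i
    g₂ = G (suc (suc N)) i
    h₀ = H N j
    h₁ = H (suc N) j
    h₂ = H (suc (suc N)) j

  -- One step passes from the second factor to the first by `green`. The top boundary terms vanish
  -- because N exceeds `suc i`. At the bottom `P 0 (suc i)` is 0, so only the term with `H 0 j`
  -- survives.
  transfer : ∀ {H} → Harmonic H → ∀ i j N → suc i < N →
    ∑ N (λ d → P d (suc i) * H d (suc j))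
    ≈ ∑ N (λ d → P d (suc (suc i)) * H d j) + x * (P 1 (suc i) * H 0 j)
  transfer {H} harm i j N i<N = begin
    A                                         ≈⟨ solve 4 (λ x A h k → A := A :+ x :* (con 0 :* h) :+ x :* (con 0 :* k)) refl x A _ _ ⟩
    A + x * (0# * H 1 j) + x * (0# * H N j)   ≈⟨ +-congˡ (*-congˡ (*-congʳ (P-vanishes (ℕ.m≤n⇒m≤1+n i<N)))) ⟨
    A + x * (0# * H 1 j) + x * (P (suc N) (suc i) * H N j)
      ≈⟨ green {P} (λ _ _ → refl) harm (suc i) j N ⟩
    B + x * (P N (suc i) * H (suc N) j)       ≈⟨ +-congˡ (*-congˡ (*-congʳ (P-vanishes i<N))) ⟩
    B + x * (0# * H (suc N) j)                ≈⟨ solve 3 (λ x B h → B :+ x :* (con 0 :* h) := B) refl x B _ ⟩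
    B ∎
    where
    A = ∑ N (λ d → P d (suc i) * H d (suc j))
    B = ∑ N (λ d → P d (suc (suc i)) * H d j) + x * (P 1 (suc i) * H 0 j)

  -- Iterates `transfer`, with the bottom term killed by the hypothesis on `H 0`. It stops with one
  -- step left, because `H 0 0` need not vanish.
  transfer* : ∀ {H} → Harmonic H → (∀ n → H 0 (suc n) ≈ 0#) → ∀ i j N → i ℕ.+ j < N →
    ∑ N (λ d → P d (suc i) * H d (suc j)) ≈ ∑ N (λ d → P d (suc (i ℕ.+ j)) * H d 1)
  transfer* {H} harm H0 i zero    N i<N rewrite ℕ.+-identityʳ i = refl
  transfer* {H} harm H0 i (suc j) N i<N rewrite ℕ.+-suc i j = begin
    ∑ N (λ d → P d (suc i) * H d (suc (suc j)))
      ≈⟨ transfer harm i (suc j) N (ℕ.≤-<-trans (s≤s (ℕ.m≤m+n i j)) i<N) ⟩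
    ∑ N (λ d → P d (suc (suc i)) * H d (suc j)) + x * (P 1 (suc i) * H 0 (suc j))
      ≈⟨ +-cong (transfer* harm H0 (suc i) j N i<N) (*-congˡ (trans (*-congˡ (H0 j)) (zeroʳ _))) ⟩
    ∑ N (λ d → P d (suc (suc (i ℕ.+ j))) * H d 1) + x * 0#
      ≈⟨ trans (+-congˡ (zeroʳ x)) (+-identityʳ _) ⟩
    ∑ N (λ d → P d (suc (suc (i ℕ.+ j))) * H d 1) ∎

  ∑-P₁ : ∀ N (f : ℕ → Carrier) → ∑ (suc N) (λ d → P d 1 * f d) ≈ x * f 1
  ∑-P₁ N f = trans
    (∑-head N (λ d → solve 3 (λ x s a → (x :* con 0 :+ s :* con 0 :+ x :* con 0) :* a := con 0) refl x s _))
    (solve 3 (λ x s a → (x :* con 1 :+ s :* con 0 :+ x :* con 0) :* a := x :* a) refl x s _)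

  -- With one factor reversed in time, both sides weigh the positive excursions of length i + j + 2:
  -- the left by the height d at an interior time, the right by the first step up. The value
  -- therefore does not depend on where the excursion is cut.
  P-pairing : ∀ i j N → i ℕ.+ j < suc N →
    ∑ (suc N) (λ d → P d (suc i) * P d (suc j)) ≈ x * P 1 (suc (i ℕ.+ j))
  P-pairing i j N i+j<N = begin
    ∑ (suc N) (λ d → P d (suc i) * P d (suc j))        ≈⟨ transfer* {P} (λ _ _ → refl) (λ _ → refl) i j (suc N) i+j<N ⟩
    ∑ (suc N) (λ d → P d (suc (i ℕ.+ j)) * P d 1)      ≈⟨ ∑-cong (suc N) (λ d → *-comm _ _) ⟩
    ∑ (suc N) (λ d → P d 1 * P d (suc (i ℕ.+ j)))      ≈⟨ ∑-P₁ N (λ d → P d (suc (i ℕ.+ j))) ⟩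
    x * P 1 (suc (i ℕ.+ j))                            ∎

  -- The left side weighs walks of m + 2 steps that leave 0 upwards and avoid it before the end.
  -- Reversed, those ending at an even d > 0 become first-passage walks from d; those ending at 0
  -- give the last term.
  Q₁-expansion : ∀ m N → suc m < suc N →
    x * Q 1 (suc m) ≈ ∑ (suc N) (λ d → P d (suc (suc m)) * ⟦ isEven d ⟧) + x * P 1 (suc m)
  Q₁-expansion m N m<N = begin
    x * Q 1 (suc m)
      ≈⟨ ∑-P₁ N (λ d → Q d (suc m)) ⟨
    ∑ (suc N) (λ d → P d 1 * Q d (suc m))
      ≈⟨ transfer* {Q} (λ _ _ → refl) (λ _ → refl) 0 m (suc N) (ℕ.<-trans (ℕ.n<1+n m) m<N) ⟩
    ∑ (suc N) (λ d → P d (suc m) * Q d 1)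
      -- The last step needs plain `transfer`: its boundary term contains `Q 0 0`, which is 1, and
      -- accounts for the walks ending at 0.
      ≈⟨ transfer {Q} (λ _ _ → refl) m 0 (suc N) m<N ⟩
    ∑ (suc N) (λ d → P d (suc (suc m)) * ⟦ isEven d ⟧) + x * (P 1 (suc m) * 1#)
      ≈⟨ +-congˡ (*-congˡ (*-identityʳ _)) ⟩
    ∑ (suc N) (λ d → P d (suc (suc m)) * ⟦ isEven d ⟧) + x * P 1 (suc m) ∎

  -- Even end heights and the induction on the number of zeros.

  ∑-even : ∀ M (f : ℕ → Carrier) → ∑ (double M) (λ d → f d * ⟦ isEven d ⟧) ≈ ∑ M (λ h → f (double h))
  ∑-even zero    f = refl
  ∑-even (suc M) f rewrite isEven-double M | isEven-suc-double M = begin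
    ∑ (double M) (λ d → f d * ⟦ isEven d ⟧) + f (suc (double M)) * 0# + f (double (suc M)) * 1#
      ≈⟨ solve 3 (λ a b c → a :+ b :* con 0 :+ c :* con 1 := a :+ c) refl _ _ _ ⟩
    ∑ (double M) (λ d → f d * ⟦ isEven d ⟧) + f (double (suc M))
      ≈⟨ +-congʳ (∑-even M f) ⟩
    ∑ M (λ h → f (double h)) + f (double (suc M)) ∎

  diag-const : ∀ a n → diag (λ _ _ → a) n ≈ suc n × a
  diag-const a zero    = sym (+-identityʳ a)
  diag-const a (suc n) = +-congˡ (diag-const a n)

  -- Each descent from 2h is cut at h. For a fixed cut time, summing over h gives all positive
  -- excursions of length m + 2, by `P-pairing`, and there are m + 1 interior cut times.
  ∑-P-double : ∀ m M → m < suc M →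
    ∑ (suc M) (λ h → P (double h) (suc (suc m))) ≈ suc m × (x * P 1 (suc m))
  ∑-P-double m M m<M = begin
    ∑ (suc M) (λ h → P (double h) (suc (suc m)))
      ≈⟨ ∑-cong (suc M) (λ h → split (suc h)) ⟩
    ∑ (suc M) (λ h → (P h ⊛ P h) (suc (suc m)))
      ≈⟨ ∑-diag (suc M) (λ h i j → P h i * P h j) (suc (suc m)) ⟩
    φ 0 (suc (suc m)) + diag (λ i → φ (suc i)) (suc m)
      -- The ends i = 0 and j = 0 of the antidiagonal drop out, since `P h 0` is 0 for h ≥ 1.
      ≈⟨ +-cong (∑-0 (suc M) (λ h → zeroˡ _)) (diag-last (λ i → φ (suc i)) m) ⟩
    0# + (diag (λ i j → φ (suc i) (suc j)) m + φ (suc (suc m)) 0)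
      ≈⟨ trans (+-identityˡ _) (+-congˡ (∑-0 (suc M) (λ h → zeroʳ _))) ⟩
    diag (λ i j → φ (suc i) (suc j)) m + 0#
      ≈⟨ +-identityʳ _ ⟩
    diag (λ i j → φ (suc i) (suc j)) m
      ≈⟨ diag-cong-on m inner ⟩
    diag (λ _ _ → x * P 1 (suc m)) m
      ≈⟨ diag-const _ m ⟩
    suc m × (x * P 1 (suc m)) ∎
    where
    φ : ℕ → ℕ → Carrier
    φ i j = ∑ (suc M) (λ h → P h i * P h j)
    split : ∀ h → P (double h) (suc (suc m)) ≈ (P h ⊛ P h) (suc (suc m))
    split h rewrite double≡ h = P-convolution h h (suc (suc m))
    inner : ∀ i j → i ℕ.+ j ≡ m → φ (suc i) (suc j) ≈ x * P 1 (suc m)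
    inner i j ≡.refl = P-pairing i j M m<M

  -- For n = m + 1, positive even ends contribute m + 1 copies of the excursions and the end 0 one
  -- more: m + 2 in all, the length of the excursion. The factor x stays because it cannot be
  -- cancelled in a semiring.
  xQ₁ : ∀ n → x * Q 1 n ≈ suc n × (x * P 1 n)
  xQ₁ zero    = sym (×-homo-1 _)
  xQ₁ (suc m) = begin
    x * Q 1 (suc m)
      -- The cutoff for heights is `double (suc m)`: even, as `∑-even` requires, and larger than m +
      -- 1.
      ≈⟨ Q₁-expansion m (suc (double m)) (s≤s (s≤s (m≤double m))) ⟩
    ∑ (double (suc m)) (λ d → P d (suc (suc m)) * ⟦ isEven d ⟧) + x * P 1 (suc m)
      ≈⟨ +-congʳ (trans (∑-even (suc m) (λ d → P d (suc (suc m)))) (∑-P-double m m (ℕ.n<1+n m))) ⟩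
    suc m × (x * P 1 (suc m)) + x * P 1 (suc m)
      ≈⟨ +-comm _ _ ⟩
    suc (suc m) × (x * P 1 (suc m)) ∎
    where
    m≤double : ∀ m → m ≤ double m
    m≤double zero    = z≤n
    m≤double (suc m) = s≤s (ℕ.m≤n⇒m≤1+n (m≤double m))

  sP₀ : ∀ n → s * P 0 n ≈ suc n × (s * P 0 n)
  sP₀ zero    = sym (×-homo-1 _)
  sP₀ (suc n) = begin
    s * 0#                   ≈⟨ zeroʳ s ⟩
    0#                       ≈⟨ zeroʳ _ ⟨
    suc (suc n) × s * 0#     ≈⟨ ×-assoc-* (suc (suc n)) s 0# ⟩
    suc (suc n) × (s * 0#)   ∎

  -- The case k = 0, sorted by the first step. A level step must be the whole walk, of length 1;
  -- steps up and down contribute equally, each by `xQ₁`.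
  V-even-0 : ∀ n → V isEven 0 n ≈ θ F n
  V-even-0 zero    = refl
  V-even-0 (suc n) = begin
    s * Q 0 n + (x + x) * Q 1 n                              ≈⟨ +-cong (*-congˡ (Q₀≈P₀ n)) (distribʳ _ _ _) ⟩
    s * P 0 n + (x * Q 1 n + x * Q 1 n)                      ≈⟨ +-cong (sP₀ n) (+-cong (xQ₁ n) (xQ₁ n)) ⟩
    suc n × (s * P 0 n) + (suc n × (x * P 1 n) + suc n × (x * P 1 n))
      ≈⟨ +-congˡ (×-distrib-+ _ _ (suc n)) ⟨
    suc n × (s * P 0 n) + suc n × (x * P 1 n + x * P 1 n)    ≈⟨ ×-distrib-+ _ _ (suc n) ⟨
    suc n × (s * P 0 n + (x * P 1 n + x * P 1 n))            ≈⟨ ×-congʳ (suc n) (+-congˡ (distribʳ _ _ _)) ⟨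
    suc n × (s * P 0 n + (x + x) * P 1 n)                    ∎
    where
    Q₀≈P₀ : ∀ n → Q 0 n ≈ P 0 n
    Q₀≈P₀ zero    = refl
    Q₀≈P₀ (suc n) = refl

  -- The cut at the last interior zero, obtained from cuts at the first one by commutativity.
  V-even-suc : ∀ k n → (V isEven 0 ⊛ V isZero k) n ≈ V isEven (suc k) n
  V-even-suc zero    n = trans (⊛-comm (V isEven 0) F n) (sym (V-suc isEven 0 n))
  V-even-suc (suc k) n = begin
    (V isEven 0 ⊛ V isZero (suc k)) n     ≈⟨ ⊛-cong {V isEven 0} (λ _ → refl) (V-suc isZero k) n ⟩
    (V isEven 0 ⊛ (F ⊛ V isZero k)) n     ≈⟨ x∙yz≈y∙xz (V isEven 0) F (V isZero k) n ⟩
    (F ⊛ (V isEven 0 ⊛ V isZero k)) n     ≈⟨ ⊛-cong {F} (λ _ → refl) (V-even-suc k) n ⟩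
    (F ⊛ V isEven (suc k)) n         ≈⟨ V-suc isEven (suc k) n ⟨
    V isEven (suc (suc k)) n         ∎

  -- In closed form `V isZero k` is F^(k+1) and `V isEven k` is F^k · θF, so this is the power rule
  -- θ(F^(k+1)) = (k+1) F^k θF.
  V-even≈θV-δ : ∀ k n → suc k × V isEven k n ≈ n × V isZero k n
  V-even≈θV-δ zero    n = trans (×-homo-1 _) (V-even-0 n)
  V-even≈θV-δ (suc k) n = begin
    V isEven (suc k) n + suc k × V isEven (suc k) n
      -- One copy is cut at the last zero, giving the θF term of the Leibniz rule; the other k + 1
      -- are cut at the first zero, which leaves the induction hypothesis as second factor.
      ≈⟨ +-cong (sym (V-even-suc k n)) (×-congʳ (suc k) (V-suc isEven k n)) ⟩
    (V isEven 0 ⊛ V isZero k) n + suc k × (F ⊛ V isEven k) n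
      ≈⟨ +-cong (⊛-cong {h = V isZero k} V-even-0 (λ _ → refl) n) (sym (diag-× (suc k) _ n)) ⟩
    (θ F ⊛ V isZero k) n + diag (λ i j → suc k × (F i * V isEven k j)) n
      ≈⟨ +-congˡ (diag-cong (λ i j → trans (sym (×-comm-* (suc k) _ _)) (*-congˡ (V-even≈θV-δ k j))) n) ⟩
    (θ F ⊛ V isZero k) n + (F ⊛ θ (V isZero k)) n
      ≈⟨ θ-⊛ F (V isZero k) n ⟨
    n × (F ⊛ V isZero k) n
      ≈⟨ ×-congʳ n (V-suc isZero k n) ⟨
    n × V isZero (suc k) n ∎

-- Pairs of paths as walks of their difference.

open import Defs
open import Data.Integer as ℤ using (ℤ; +_; -[1+_]; ∣_∣; +0; 1ℤ)
import Data.Integer.Properties as ℤ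
open import Data.Vec using ([]; _∷_)
open import Relation.Nullary using (does)

-- Defined by cases on the sign rather than as d ± 1, so that heights compute in the clauses of
-- `∑term`.
up down : ℤ → ℤ
up (+ n)        = + suc n
up -[1+ zero ]  = +0
up -[1+ suc n ] = -[1+ n ]
down (+ zero)   = -[1+ 0 ]
down (+ suc n)  = + n
down -[1+ n ]   = -[1+ suc n ]

advance : Step → Step → ℤ → ℤ
advance E E d = d
advance E N d = up d
advance N E d = down d
advance N N d = d

hit : ℤ → ℕ
hit d = if does (d ℤ.≟ +0) then 1 else 0

-- The final time is left out, matching the convention of `T`.
visits : ∀ {n} → ℤ → Path n → Path n → ℕ
visits d []      []      = 0
visits d (s ∷ p) (t ∷ q) = hit d ℕ.+ visits (advance s t d) p q

final : ∀ {n} → ℤ → Path n → Path n → ℤ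
final d []      []      = d
final d (s ∷ p) (t ∷ q) = final (advance s t d) p q

#E : ∀ {n} → Path n → ℕ
#E []      = 0
#E (E ∷ p) = suc (#E p)
#E (N ∷ p) = #E p

admissible : ∀ {n} → (ℕ → Bool) → ℕ → ℤ → Path n → Path n → Bool
admissible u k d p q = (visits d p q ≡ᵇ k) ∧ u ∣ final d p q ∣

module PathSums {c ℓ} (R : CommutativeSemiring c ℓ) where
  open CommutativeSemiring R
  open import Algebra.Properties.CommutativeSemigroup +-commutativeSemigroup
    using (interchange)

  ∑ᴾ : ∀ n → (Path n → Carrier) → Carrier
  ∑ᴾ zero    f = f []
  ∑ᴾ (suc n) f = ∑ᴾ n (λ p → f (E ∷ p)) + ∑ᴾ n (λ p → f (N ∷ p))

  ∑ᴾ-cong : ∀ n {f g} → (∀ p → f p ≈ g p) → ∑ᴾ n f ≈ ∑ᴾ n g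
  ∑ᴾ-cong zero    eq = eq []
  ∑ᴾ-cong (suc n) eq = +-cong (∑ᴾ-cong n (λ p → eq (E ∷ p))) (∑ᴾ-cong n (λ p → eq (N ∷ p)))

  ∑ᴾ-+ : ∀ n f g → ∑ᴾ n (λ p → f p + g p) ≈ ∑ᴾ n f + ∑ᴾ n g
  ∑ᴾ-+ zero    f g = refl
  ∑ᴾ-+ (suc n) f g = trans (+-cong (∑ᴾ-+ n _ _) (∑ᴾ-+ n _ _)) (interchange _ _ _ _)

  ∑ᴾ-*ˡ : ∀ n a f → ∑ᴾ n (λ p → a * f p) ≈ a * ∑ᴾ n f
  ∑ᴾ-*ˡ zero    a f = refl
  ∑ᴾ-*ˡ (suc n) a f = trans (+-cong (∑ᴾ-*ˡ n a _) (∑ᴾ-*ˡ n a _)) (sym (distribˡ _ _ _))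

  ∑ᴾᴾ : ∀ n → (Path n → Path n → Carrier) → Carrier
  ∑ᴾᴾ n f = ∑ᴾ n λ p → ∑ᴾ n λ q → f p q

  ∑ᴾᴾ-cong : ∀ n {f g} → (∀ p q → f p q ≈ g p q) → ∑ᴾᴾ n f ≈ ∑ᴾᴾ n g
  ∑ᴾᴾ-cong n eq = ∑ᴾ-cong n λ p → ∑ᴾ-cong n λ q → eq p q

  ∑ᴾᴾ-*ˡ : ∀ n a f → ∑ᴾᴾ n (λ p q → a * f p q) ≈ a * ∑ᴾᴾ n f
  ∑ᴾᴾ-*ˡ n a f = trans (∑ᴾ-cong n λ p → ∑ᴾ-*ˡ n a _) (∑ᴾ-*ˡ n a _)

  ∑ᴾᴾ-suc : ∀ n f → ∑ᴾᴾ (suc n) f ≈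
    (∑ᴾᴾ n (λ p q → f (E ∷ p) (E ∷ q)) + ∑ᴾᴾ n (λ p q → f (E ∷ p) (N ∷ q))) +
    (∑ᴾᴾ n (λ p q → f (N ∷ p) (E ∷ q)) + ∑ᴾᴾ n (λ p q → f (N ∷ p) (N ∷ q)))
  ∑ᴾᴾ-suc n f = +-cong (∑ᴾ-+ n _ _) (∑ᴾ-+ n _ _)

  ∑ᴾᴾ-0 : ∀ n {f} → (∀ p q → f p q ≈ 0#) → ∑ᴾᴾ n f ≈ 0#
  ∑ᴾᴾ-0 n {f} eq = trans (∑ᴾᴾ-cong n λ p q → trans (eq p q) (sym (zeroˡ (f p q))))
    (trans (∑ᴾᴾ-*ˡ n 0# f) (zeroˡ _))

module WeightedPairs {c ℓ} (R : CommutativeSemiring c ℓ) (x : CommutativeSemiring.Carrier R) where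
  open CommutativeSemiring R
  open PathSums R
  open Convolution R using (⟦_⟧)
  open Walks R x (1# + x * x) using (T)
  open import Algebra.Solver.Ring.NaturalCoefficients.Default R
    using (solve; _:=_; _:+_; _:*_; con)
  open import Relation.Binary.Reasoning.Setoid setoid

  pow : ℕ → Carrier
  pow zero    = 1#
  pow (suc m) = x * pow m

  term : ∀ {n} → (ℕ → Bool) → ℕ → ℤ → Path n → Path n → Carrier
  term u k d p q = ⟦ admissible u k d p q ⟧ * pow (#E p ℕ.+ #E q)

  -- EE and NN both keep the difference, at e, and weigh x² and 1: hence the level weight 1 + x². EN
  -- leads to f and NE to g, each with weight x.
  stepSums : ∀ n u k (e f g : ℤ) →
    (∑ᴾᴾ n (λ p q → ⟦ admissible u k e p q ⟧ * pow (suc (#E p) ℕ.+ suc (#E q)))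
     + ∑ᴾᴾ n (λ p q → ⟦ admissible u k f p q ⟧ * pow (suc (#E p) ℕ.+ #E q)))
    + (∑ᴾᴾ n (λ p q → ⟦ admissible u k g p q ⟧ * pow (#E p ℕ.+ suc (#E q)))
       + ∑ᴾᴾ n (term u k e))
    ≈ x * ∑ᴾᴾ n (term u k g) + (1# + x * x) * ∑ᴾᴾ n (term u k e) + x * ∑ᴾᴾ n (term u k f)
  stepSums n u k e f g = begin
    _ ≈⟨ +-cong (+-cong EE EN) (+-congʳ NE) ⟩
    (x * x * A + x * B) + (x * C + A)
      ≈⟨ solve 4 (λ x A B C → (x :* x :* A :+ x :* B) :+ (x :* C :+ A)
                   := x :* C :+ (con 1 :+ x :* x) :* A :+ x :* B) refl x A B C ⟩
    x * C + (1# + x * x) * A + x * B ∎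
    where
    A = ∑ᴾᴾ n (term u k e)
    B = ∑ᴾᴾ n (term u k f)
    C = ∑ᴾᴾ n (term u k g)
    EN : ∑ᴾᴾ n (λ p q → ⟦ admissible u k f p q ⟧ * pow (suc (#E p) ℕ.+ #E q)) ≈ x * B
    EN = trans (∑ᴾᴾ-cong n λ p q → solve 3 (λ a x b → a :* (x :* b) := x :* (a :* b)) refl _ x _)
               (∑ᴾᴾ-*ˡ n x _)
    NE : ∑ᴾᴾ n (λ p q → ⟦ admissible u k g p q ⟧ * pow (#E p ℕ.+ suc (#E q))) ≈ x * C
    NE = trans (∑ᴾᴾ-cong n λ p q → trans
           (*-congˡ (reflexive (≡.cong pow (ℕ.+-suc (#E p) (#E q)))))
           (solve 3 (λ a x b → a :* (x :* b) := x :* (a :* b)) refl _ x _))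
         (∑ᴾᴾ-*ˡ n x _)
    EE : ∑ᴾᴾ n (λ p q → ⟦ admissible u k e p q ⟧ * pow (suc (#E p) ℕ.+ suc (#E q))) ≈ x * x * A
    EE = trans (∑ᴾᴾ-cong n λ p q → trans
           (*-congˡ (*-congˡ (reflexive (≡.cong pow (ℕ.+-suc (#E p) (#E q))))))
           (solve 3 (λ a x b → a :* (x :* (x :* b)) := x :* x :* (a :* b)) refl _ x _))
         (∑ᴾᴾ-*ˡ n (x * x) _)

  -- Steps up and down have equal weight, and zeros and `u` depend on the absolute value only, so
  -- the walk may be folded at 0.
  ∑term : ∀ n u k d → ∑ᴾᴾ n (term u k d) ≈ T u n ∣ d ∣ k
  ∑term zero u zero    d = *-identityʳ _
  ∑term zero u (suc k) d = zeroˡ _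
  ∑term (suc n) u zero (+ zero) = ∑ᴾᴾ-0 (suc n) {term u 0 (+ 0)} λ { (_ ∷ _) (_ ∷ _) → zeroˡ _ }
  ∑term (suc n) u (suc k) (+ zero) = begin
    ∑ᴾᴾ (suc n) (term u (suc k) (+ 0))      ≈⟨ ∑ᴾᴾ-suc n (term u (suc k) (+ 0)) ⟩
    _                                       ≈⟨ stepSums n u k (+ 0) (+ 1) -[1+ 0 ] ⟩
    x * ∑ᴾᴾ n (term u k -[1+ 0 ]) + (1# + x * x) * ∑ᴾᴾ n (term u k (+ 0)) + x * ∑ᴾᴾ n (term u k (+ 1))
      ≈⟨ +-cong (+-cong (*-congˡ (∑term n u k -[1+ 0 ])) (*-congˡ (∑term n u k (+ 0)))) (*-congˡ (∑term n u k (+ 1))) ⟩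
    x * T u n 1 k + (1# + x * x) * T u n 0 k + x * T u n 1 k
      -- From 0 both +1 and -1 lead to absolute height 1: the origin of x + x in `T`.
      ≈⟨ solve 3 (λ x a b → x :* a :+ b :+ x :* a := b :+ (x :+ x) :* a) refl x _ _ ⟩
    (1# + x * x) * T u n 0 k + (x + x) * T u n 1 k ∎
  ∑term (suc n) u k (+ suc m) = begin
    ∑ᴾᴾ (suc n) (term u k (+ suc m))        ≈⟨ ∑ᴾᴾ-suc n (term u k (+ suc m)) ⟩
    _                                       ≈⟨ stepSums n u k (+ suc m) (+ suc (suc m)) (+ m) ⟩
    _ ≈⟨ +-cong (+-cong (*-congˡ (∑term n u k (+ m))) (*-congˡ (∑term n u k (+ suc m))))
                (*-congˡ (∑term n u k (+ suc (suc m)))) ⟩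
    T u (suc n) (suc m) k ∎
  ∑term (suc n) u k -[1+ m ] = begin
    ∑ᴾᴾ (suc n) (term u k -[1+ m ])         ≈⟨ ∑ᴾᴾ-suc n (term u k -[1+ m ]) ⟩
    _                                       ≈⟨ stepSums n u k -[1+ m ] (up -[1+ m ]) -[1+ suc m ] ⟩
    _ ≈⟨ +-cong (+-cong (*-congˡ (∑term n u k -[1+ suc m ])) (*-congˡ (∑term n u k -[1+ m ])))
                (*-congˡ (trans (∑term n u k (up -[1+ m ])) (reflexive (≡.cong (λ d → T u n d k) (∣up∣ m))))) ⟩
    x * T u n (suc (suc m)) k + (1# + x * x) * T u n (suc m) k + x * T u n m k
      ≈⟨ solve 3 (λ a b c → a :+ b :+ c := c :+ b :+ a) refl _ _ _ ⟩
    T u (suc n) (suc m) k ∎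
    where
    ∣up∣ : ∀ m → ∣ up -[1+ m ] ∣ ≡ m
    ∣up∣ zero    = ≡.refl
    ∣up∣ (suc m) = ≡.refl

import Algebra.Properties.AbelianGroup as AbelianGroup
import Algebra.Properties.CommutativeSemigroup as CommutativeSemigroup
open import Data.Bool using (T)
open import Data.Bool.Properties using (T?)
open import Data.Fin using (Fin; zero; suc; toℕ; fromℕ)
open import Data.Integer.Tactic.RingSolver using (solve-∀)
open import Data.List using ([]; _∷_; _++_; map; filter; length; tabulate; cartesianProduct; cartesianProductWith)
import Data.List.Properties as List
open import Data.List.Membership.Propositional using (_∈_)
open import Data.List.Membership.Propositional.Properties
  using (∈-filter⁺; ∈-filter⁻; ∈-cartesianProduct⁺; ∈-map⁺; ∈-upTo⁺)
open import Data.List.Relation.Unary.All as All using ([]; _∷_)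
open import Data.List.Relation.Unary.AllPairs using ([]; _∷_)
open import Data.List.Relation.Unary.Any using (here; there)
open import Data.List.Relation.Unary.Unique.Propositional using (Unique)
import Data.List.Relation.Unary.Unique.Propositional.Properties as Unique
open import Data.Nat.ListAction using (sum)
open import Data.Nat.ListAction.Properties using (sum-++)
open import Data.Product using (_×_; _,_; proj₁; proj₂)
open import Data.Rational using (_/_; _*_; toℚᵘ)
import Data.Rational.Properties as ℚ
import Data.Rational.Unnormalised as ℚᵘ
import Data.Rational.Unnormalised.Properties as ℚᵘ
open import Function using (mk⇔; _∘_; id)
open import Relation.Binary.PropositionalEquality
open import Relation.Nullary using (Dec; yes; no; contradiction; _×-dec_)
open import Relation.Nullary.Decidable using (does-⇔; dec-false)
open import Relation.Unary using (Decidable)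

open Convolution ℕ.+-*-commutativeSemiring using () renaming (⟦_⟧ to 𝟙)
private module ℤ-group = AbelianGroup ℤ.+-0-abelianGroup
open PathSums ℕ.+-*-commutativeSemiring

-- Counting in lists as summation.

module _ {A : Set} where

  length-filter : ∀ {P : A → Set} (P? : Decidable P) xs →
    length (filter P? xs) ≡ sum (map (λ a → 𝟙 (does (P? a))) xs)
  length-filter P? []       = refl
  length-filter P? (a ∷ xs) with does (P? a)
  ... | true  = cong suc (length-filter P? xs)
  ... | false = length-filter P? xs

  sum-map-cong : ∀ {f g : A → ℕ} → (∀ a → f a ≡ g a) → ∀ xs → sum (map f xs) ≡ sum (map g xs)
  sum-map-cong eq xs = cong sum (List.map-cong eq xs)

  sum-map-+ : ∀ (f g : A → ℕ) xs →
    sum (map (λ a → f a ℕ.+ g a) xs) ≡ sum (map f xs) ℕ.+ sum (map g xs)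
  sum-map-+ f g []       = refl
  sum-map-+ f g (a ∷ xs) = trans (cong (f a ℕ.+ g a ℕ.+_) (sum-map-+ f g xs))
    (CommutativeSemigroup.interchange ℕ.+-commutativeSemigroup (f a) (g a) _ _)

  sum-map-0 : ∀ {f : A → ℕ} xs → (∀ {a} → a ∈ xs → f a ≡ 0) → sum (map f xs) ≡ 0
  sum-map-0 []       eq = refl
  sum-map-0 (a ∷ xs) eq = cong₂ ℕ._+_ (eq (here refl)) (sum-map-0 xs (eq ∘ there))

  sum-map-unique : ∀ {f : A → ℕ} {e xs} → Unique xs → e ∈ xs → (∀ a → a ≢ e → f a ≡ 0) →
    sum (map f xs) ≡ f e
  sum-map-unique {f} {e} {_ ∷ xs} (e∉ ∷ _) (here refl) off =
    trans (cong (f e ℕ.+_) (sum-map-0 xs λ a∈ → off _ (≢-sym (All.lookup e∉ a∈)))) (ℕ.+-identityʳ _)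
  sum-map-unique {f} {e} (a∉ ∷ u) (there e∈) off =
    cong₂ ℕ._+_ (off _ (All.lookup a∉ e∈)) (sum-map-unique u e∈ off)

sum-map-swap : ∀ {A B : Set} (f : A → B → ℕ) xs ys →
  sum (map (λ a → sum (map (f a) ys)) xs) ≡ sum (map (λ b → sum (map (λ a → f a b) xs)) ys)
sum-map-swap f []       ys = sym (sum-map-0 ys λ _ → refl)
sum-map-swap f (a ∷ xs) ys =
  trans (cong (sum (map (f a) ys) ℕ.+_) (sum-map-swap f xs ys)) (sym (sum-map-+ (f a) _ ys))

sum-cartesianProductWith : ∀ {A B C : Set} (c : A → B → C) (f : C → ℕ) xs ys →
  sum (map f (cartesianProductWith c xs ys)) ≡ sum (map (λ a → sum (map (λ b → f (c a b)) ys)) xs)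
sum-cartesianProductWith c f []       ys = refl
sum-cartesianProductWith c f (a ∷ xs) ys = begin
  sum (map f (map (c a) ys ++ cartesianProductWith c xs ys))
    ≡⟨ cong sum (List.map-++ f (map (c a) ys) _) ⟩
  sum (map f (map (c a) ys) ++ map f (cartesianProductWith c xs ys))
    ≡⟨ sum-++ (map f (map (c a) ys)) _ ⟩
  sum (map f (map (c a) ys)) ℕ.+ sum (map f (cartesianProductWith c xs ys))
    ≡⟨ cong₂ ℕ._+_ (cong sum (sym (List.map-∘ ys))) (sum-cartesianProductWith c f xs ys) ⟩
  sum (map (λ b → f (c a b)) ys) ℕ.+ _ ∎
  where open ≡-Reasoning

sum-paths : ∀ n f → sum (map f (paths n)) ≡ ∑ᴾ n f
sum-paths zero    f = ℕ.+-identityʳ _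
sum-paths (suc n) f = trans (sum-cartesianProductWith _∷_ f steps (paths n))
  (cong₂ ℕ._+_ (sum-paths n _) (trans (ℕ.+-identityʳ _) (sum-paths n _)))

sum-pairs : ∀ n (f : Path n × Path n → ℕ) →
  sum (map f (cartesianProduct (paths n) (paths n))) ≡ ∑ᴾᴾ n (λ p q → f (p , q))
sum-pairs n f = trans (sum-cartesianProductWith _,_ f (paths n) (paths n))
  (trans (sum-paths n _) (∑ᴾ-cong n λ p → sum-paths n _))

-- Intersections as zeros of the difference walk.

countFin : ∀ m → (Fin m → Bool) → ℕ
countFin zero    b = 0
countFin (suc m) b = 𝟙 (b zero) ℕ.+ countFin m (b ∘ suc)

length-filter-tabulate : ∀ {A : Set} {P : A → Set} (P? : Decidable P) m (f : Fin m → A) →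
  length (filter P? (tabulate f)) ≡ countFin m (λ i → does (P? (f i)))
length-filter-tabulate P? zero    f = refl
length-filter-tabulate P? (suc m) f with does (P? (f zero))
... | true  = cong suc (length-filter-tabulate P? m (f ∘ suc))
... | false = length-filter-tabulate P? m (f ∘ suc)

-- On a common antidiagonal the two points differ by a multiple of (1 , -1).
Apart : ℤ → Point → Point → Set
Apart d (a₁ , a₂) (b₁ , b₂) = a₁ ≡ b₁ ℤ.+ d × b₂ ≡ a₂ ℤ.+ d

up≡ : ∀ d → up d ≡ d ℤ.+ 1ℤ
up≡ (+ n)        = cong +_ (ℕ.+-comm 1 n)
up≡ -[1+ zero ]  = refl
up≡ -[1+ suc n ] = refl

down≡ : ∀ d → down d ≡ d ℤ.- 1ℤ
down≡ (+ zero)  = refl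
down≡ (+ suc n) = refl
down≡ -[1+ n ]  = cong (λ m → -[1+ suc m ]) (sym (ℕ.+-identityʳ n))

Apart-move : ∀ s t {d} a b → Apart d a b → Apart (advance s t d) (move s a) (move t b)
Apart-move E E {d} (_ , a₂) (b₁ , _) (refl , refl) = lemma b₁ d , refl
  where
  lemma : ∀ b d → b ℤ.+ d ℤ.+ 1ℤ ≡ b ℤ.+ 1ℤ ℤ.+ d
  lemma = solve-∀
Apart-move N N {d} (_ , a₂) (b₁ , _) (refl , refl) = refl , lemma a₂ d
  where
  lemma : ∀ b d → b ℤ.+ d ℤ.+ 1ℤ ≡ b ℤ.+ 1ℤ ℤ.+ d
  lemma = solve-∀
Apart-move E N {d} (_ , a₂) (b₁ , _) (refl , refl) rewrite up≡ d =
  ℤ.+-assoc b₁ d 1ℤ , ℤ.+-assoc a₂ d 1ℤ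
Apart-move N E {d} (_ , a₂) (b₁ , _) (refl , refl) rewrite down≡ d = lemma b₁ d , lemma a₂ d
  where
  lemma : ∀ b d → b ℤ.+ d ≡ b ℤ.+ 1ℤ ℤ.+ (d ℤ.- 1ℤ)
  lemma = solve-∀

hit-correct : ∀ d a b → Apart d a b → 𝟙 (does (a ≟ᴾ b)) ≡ hit d
hit-correct d a b (e₁ , e₂) = cong 𝟙 (does-⇔ (mk⇔ to from) (a ≟ᴾ b) (d ℤ.≟ +0))
  where
  to : a ≡ b → d ≡ +0
  to refl = ℤ-group.identityʳ-unique (proj₁ b) d (sym e₁)
  from : d ≡ +0 → a ≡ b
  from refl = cong₂ _,_ (trans e₁ (ℤ.+-identityʳ _)) (sym (trans e₂ (ℤ.+-identityʳ _)))

visits-correct : ∀ {n} d a b (p q : Path n) → Apart d a b →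
  countFin (suc n) (λ m → (toℕ m <ᵇ n) ∧ does (pointFrom a p m ≟ᴾ pointFrom b q m)) ≡ visits d p q
visits-correct d a b []      []      ap = refl
visits-correct d a b (s ∷ p) (t ∷ q) ap = cong₂ ℕ._+_ (hit-correct d a b ap)
  (visits-correct (advance s t d) (move s a) (move t b) p q (Apart-move s t a b ap))

-- The extra visit is the common origin at time 0. The length has to be positive here: for empty
-- paths time 0 is the final time and `visits` is 0.
visits≡1+intersections : ∀ {n} (p q : Path (suc n)) → visits +0 p q ≡ suc (#intersections p q)
visits≡1+intersections {n} (s ∷ p) (t ∷ q) = cong suc (sym (trans
  (length-filter-tabulate (intersect? (s ∷ p) (t ∷ q)) (suc (suc n)) id)
  (visits-correct _ _ _ p q (Apart-move s t {+0} origin origin (refl , refl)))))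

-- Endpoints in terms of E-counts.

final≡ : ∀ {n} d (p q : Path n) → final d p q ≡ d ℤ.+ (#E p ℤ.⊖ #E q)
final≡ d []      []      = sym (ℤ.+-identityʳ d)
final≡ d (E ∷ p) (E ∷ q) rewrite ℤ.[1+m]⊖[1+n]≡m⊖n (#E p) (#E q) = final≡ d p q
final≡ d (N ∷ p) (N ∷ q) = final≡ d p q
final≡ d (E ∷ p) (N ∷ q) = begin
  final (up d) p q                    ≡⟨ final≡ (up d) p q ⟩
  up d ℤ.+ (#E p ℤ.⊖ #E q)            ≡⟨ cong (ℤ._+ _) (up≡ d) ⟩
  d ℤ.+ 1ℤ ℤ.+ (#E p ℤ.⊖ #E q)        ≡⟨ ℤ.+-assoc d 1ℤ _ ⟩
  d ℤ.+ (1ℤ ℤ.+ (#E p ℤ.⊖ #E q))      ≡⟨ cong (ℤ._+_ d) (ℤ.distribʳ-⊖-+-pos 1 (#E p) (#E q)) ⟩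
  d ℤ.+ (suc (#E p) ℤ.⊖ #E q)         ∎
  where open ≡-Reasoning
final≡ d (N ∷ p) (E ∷ q) = begin
  final (down d) p q                  ≡⟨ final≡ (down d) p q ⟩
  down d ℤ.+ (#E p ℤ.⊖ #E q)          ≡⟨ cong (ℤ._+ _) (down≡ d) ⟩
  d ℤ.- 1ℤ ℤ.+ (#E p ℤ.⊖ #E q)        ≡⟨ ℤ.+-assoc d (ℤ.- 1ℤ) _ ⟩
  d ℤ.+ (ℤ.- 1ℤ ℤ.+ (#E p ℤ.⊖ #E q))  ≡⟨ cong (ℤ._+_ d) (ℤ.distribʳ-⊖-+-neg 0 (#E p) (#E q)) ⟩
  d ℤ.+ (#E p ℤ.⊖ suc (#E q))         ∎
  where open ≡-Reasoning

#E≤n : ∀ {n} (p : Path n) → #E p ≤ n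
#E≤n []      = z≤n
#E≤n (E ∷ p) = s≤s (#E≤n p)
#E≤n (N ∷ p) = ℕ.m≤n⇒m≤1+n (#E≤n p)

endpointFrom : ∀ {n} a (p : Path n) →
  pointFrom a p (fromℕ n) ≡ (proj₁ a ℤ.+ + #E p , proj₂ a ℤ.+ (+ n ℤ.- + #E p))
endpointFrom (a₁ , a₂) [] = cong₂ _,_ (sym (ℤ.+-identityʳ a₁)) (sym (ℤ.+-identityʳ a₂))
endpointFrom {suc n} (a₁ , a₂) (E ∷ p) = trans (endpointFrom _ p)
  (cong₂ _,_ (ℤ.+-assoc a₁ 1ℤ (+ #E p)) (cong (ℤ._+_ a₂) (lemma (+ n) (+ #E p))))
  where
  lemma : ∀ n e → n ℤ.- e ≡ (1ℤ ℤ.+ n) ℤ.- (1ℤ ℤ.+ e)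
  lemma = solve-∀
endpointFrom {suc n} (a₁ , a₂) (N ∷ p) = trans (endpointFrom _ p)
  (cong (a₁ ℤ.+ + #E p ,_) (lemma a₂ (+ n) (+ #E p)))
  where
  lemma : ∀ a n e → a ℤ.+ 1ℤ ℤ.+ (n ℤ.- e) ≡ a ℤ.+ ((1ℤ ℤ.+ n) ℤ.- e)
  lemma = solve-∀

endpoint≡ : ∀ {n} (p : Path n) → endpoint p ≡ (+ #E p , + n ℤ.- + #E p)
endpoint≡ {n} p = trans (endpointFrom origin p) (cong₂ _,_ (ℤ.+-identityˡ _) (ℤ.+-identityˡ _))

endpoint⁺ : ∀ {n r} (p : Path n) → + #E p ≡ r → endpoint p ≡ (r , + n ℤ.- r)
endpoint⁺ p refl = endpoint≡ p

endpoint⁻ : ∀ {n r} (p : Path n) → endpoint p ≡ (r , + n ℤ.- r) → + #E p ≡ r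
endpoint⁻ p eq = cong proj₁ (trans (sym (endpoint≡ p)) eq)

M-sum : ∀ n k r s → M n k r s ≡ ∑ᴾᴾ n (λ p q → 𝟙 (does (counted? n k r s (p , q))))
M-sum n k r s = trans (length-filter (counted? n k r s) (cartesianProduct (paths n) (paths n))) (sum-pairs n _)

onIndex? : ∀ {n} (k : ℕ) (P : ℤ) (p q : Path n) → Dec (+ (#E p ℕ.+ #E q) ≡ P × #intersections p q ≡ k)
onIndex? k P p q = (+ (#E p ℕ.+ #E q) ℤ.≟ P) ×-dec (#intersections p q ℕ.≟ k)

indexPairs-unique : ∀ n p → Unique (indexPairs n p)
indexPairs-unique n p = Unique.filter⁺ (λ (r , s) → r ℤ.+ s ℤ.≟ + 2 ℤ.* p) (Unique.cartesianProduct⁺ ints ints)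
  where
  ints : Unique (integersUpTo n)
  ints = Unique.map⁺ ℤ.+-injective (Unique.upTo⁺ (suc n))

-- After exchanging the sums, a pair (p , q) can only be counted at (r , s) = (`#E p` , `#E q`).
-- This index occurs exactly once if the E-counts add up to 2P, and not at all otherwise.
N-E-sum : ∀ n k P → N-E n k P ≡ ∑ᴾᴾ n (λ p q → 𝟙 (does (onIndex? k (+ 2 ℤ.* P) p q)))
N-E-sum n k P = begin
  N-E n k P
    ≡⟨ sum-map-cong (λ (r , s) → length-filter (counted? n k r s) pairs) (indexPairs n P) ⟩
  sum (map (λ (r , s) → sum (map (λ pq → 𝟙 (does (counted? n k r s pq))) pairs)) (indexPairs n P))
    ≡⟨ sum-map-swap (λ (r , s) pq → 𝟙 (does (counted? n k r s pq))) (indexPairs n P) pairs ⟩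
  sum (map (λ pq → sum (map (λ (r , s) → 𝟙 (does (counted? n k r s pq))) (indexPairs n P))) pairs)
    ≡⟨ sum-pairs n _ ⟩
  ∑ᴾᴾ n (λ p q → sum (map (λ (r , s) → 𝟙 (does (counted? n k r s (p , q)))) (indexPairs n P)))
    ≡⟨ ∑ᴾᴾ-cong n only ⟩
  ∑ᴾᴾ n (λ p q → 𝟙 (does (onIndex? k (+ 2 ℤ.* P) p q))) ∎
  where
  open ≡-Reasoning
  pairs = cartesianProduct (paths n) (paths n)
  only : ∀ p q → sum (map (λ (r , s) → 𝟙 (does (counted? n k r s (p , q)))) (indexPairs n P))
       ≡ 𝟙 (does (onIndex? k (+ 2 ℤ.* P) p q))
  only p q with + (#E p ℕ.+ #E q) ℤ.≟ + 2 ℤ.* P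
  ... | yes eq = trans
    (sum-map-unique {f = λ (r , s) → 𝟙 (does (counted? n k r s (p , q)))} (indexPairs-unique n P)
      (∈-filter⁺ (λ (r , s) → r ℤ.+ s ℤ.≟ + 2 ℤ.* P)
        (∈-cartesianProduct⁺ (∈-map⁺ +_ (∈-upTo⁺ (s≤s (#E≤n p)))) (∈-map⁺ +_ (∈-upTo⁺ (s≤s (#E≤n q))))) eq)
      (λ (r , s) rs≢ → cong 𝟙 (dec-false (counted? n k r s (p , q)) λ (ep , eq , _) →
        rs≢ (sym (cong₂ _,_ (endpoint⁻ p ep) (endpoint⁻ q eq))))))
    (cong 𝟙 (does-⇔ (mk⇔ (λ (_ , _ , i) → i) (λ i → endpoint⁺ p refl , endpoint⁺ q refl , i))
      (counted? n k (+ #E p) (+ #E q) (p , q)) (#intersections p q ℕ.≟ k)))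
  ... | no neq = sum-map-0 (indexPairs n P) λ {(r , s)} rs∈ →
    cong 𝟙 (dec-false (counted? n k r s (p , q)) λ (ep , eq , _) →
      neq (trans (cong₂ ℤ._+_ (endpoint⁻ p ep) (endpoint⁻ q eq))
        (proj₂ (∈-filter⁻ (λ (r , s) → r ℤ.+ s ℤ.≟ + 2 ℤ.* P)
           {xs = cartesianProduct (integersUpTo n) (integersUpTo n)} rs∈))))

-- Coefficients in the variable that marks E steps.

private
  module ℕ[[X]] = Convolution ℕ.+-*-commutativeSemiring
  R = ℕ[[X]].seriesSemiring
  module R where
    open Convolution R public
    open PathSums R public

X : ℕ → ℕ
X zero    = 0
X (suc w) = ℕ[[X]].one w

open WeightedPairs R X
open Walks R X (λ w → ℕ[[X]].one w ℕ.+ (X ℕ[[X]].⊛ X) w) using (V; V-even≈θV-δ)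

pow-coefficient : ∀ m w → pow m w ≡ 𝟙 (m ≡ᵇ w)
pow-coefficient zero    zero    = refl
pow-coefficient zero    (suc w) = refl
pow-coefficient (suc m) zero    = refl
pow-coefficient (suc m) (suc w) = trans (ℕ[[X]].⊛-shiftˡ X (pow m) w refl)
  (trans (ℕ[[X]].⊛-identityˡ (pow m) w) (pow-coefficient m w))

term-coefficient : ∀ b m w → (R.⟦ b ⟧ ℕ[[X]].⊛ pow m) w ≡ 𝟙 (b ∧ (m ≡ᵇ w))
term-coefficient true  m w = trans (ℕ[[X]].⊛-identityˡ (pow m) w) (pow-coefficient m w)
term-coefficient false m w = ℕ[[X]].⊛-zeroˡ (pow m) w

∑ᴾ-coefficient : ∀ n f w → R.∑ᴾ n f w ≡ ∑ᴾ n (λ p → f p w)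
∑ᴾ-coefficient zero    f w = refl
∑ᴾ-coefficient (suc n) f w = cong₂ ℕ._+_ (∑ᴾ-coefficient n _ w) (∑ᴾ-coefficient n _ w)

V-coefficient : ∀ u k n w →
  V u k n w ≡ ∑ᴾᴾ n (λ p q → 𝟙 (admissible u (suc k) +0 p q ∧ (#E p ℕ.+ #E q ≡ᵇ w)))
V-coefficient u k n w = begin
  V u k n w
    ≡⟨ ∑term n u (suc k) +0 w ⟨
  R.∑ᴾᴾ n (term u (suc k) +0) w
    ≡⟨ ∑ᴾ-coefficient n _ w ⟩
  ∑ᴾ n (λ p → R.∑ᴾ n (term u (suc k) +0 p) w)
    ≡⟨ ∑ᴾ-cong n (λ p → ∑ᴾ-coefficient n _ w) ⟩
  ∑ᴾᴾ n (λ p q → term u (suc k) +0 p q w)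
    ≡⟨ ∑ᴾᴾ-cong n (λ p q → term-coefficient (admissible u (suc k) +0 p q) (#E p ℕ.+ #E q) w) ⟩
  ∑ᴾᴾ n (λ p q → 𝟙 (admissible u (suc k) +0 p q ∧ (#E p ℕ.+ #E q ≡ᵇ w))) ∎
  where open ≡-Reasoning

-- The difference and the sum of two numbers have the same parity; this links even end heights to
-- even totals of E steps.
isEven-∣⊖∣ : ∀ a b → isEven ∣ a ℤ.⊖ b ∣ ≡ isEven (a ℕ.+ b)
isEven-∣⊖∣ zero    zero    = refl
isEven-∣⊖∣ zero    (suc b) = refl
isEven-∣⊖∣ (suc a) zero    = cong (λ c → isEven (suc c)) (sym (ℕ.+-identityʳ a))
isEven-∣⊖∣ (suc a) (suc b) rewrite ℤ.[1+m]⊖[1+n]≡m⊖n a b | ℕ.+-suc a b = isEven-∣⊖∣ a b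

-- Both counts as coefficients of X^(2p).

isZero⁻ : ∀ {d} → T (isZero d) → d ≡ 0
isZero⁻ {zero} _ = refl

double-injective : ∀ {m n} → double m ≡ double n → m ≡ n
double-injective {zero}  {zero}  _  = refl
double-injective {suc m} {suc n} eq = cong suc (double-injective (ℕ.suc-injective (ℕ.suc-injective eq)))

+double : ∀ m → + 2 ℤ.* + m ≡ + double m
+double m = trans (sym (ℤ.pos-* 2 m))
  (cong +_ (trans (cong (m ℕ.+_) (ℕ.+-identityʳ m)) (sym (double≡ m))))

-- Its `does` computes to the boolean in `V-coefficient`, so `does-⇔` can replace that boolean by a
-- logical condition.
admissible? : ∀ {n} (u : ℕ → Bool) k (p q : Path n) w →
  Dec ((visits +0 p q ≡ suc k × T (u ∣ final +0 p q ∣)) × #E p ℕ.+ #E q ≡ w)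
admissible? u k p q w =
  ((visits +0 p q ℕ.≟ suc k) ×-dec T? (u ∣ final +0 p q ∣)) ×-dec (#E p ℕ.+ #E q ℕ.≟ w)

final₀ : ∀ {n} (p q : Path n) → final +0 p q ≡ #E p ℤ.⊖ #E q
final₀ p q = trans (final≡ +0 p q) (ℤ.+-identityˡ _)

-- A total of 2m E steps already forces an even end height, so `isEven` imposes nothing further on
-- this coefficient.
N-E≡V : ∀ n k m → N-E (suc n) k (+ m) ≡ V isEven k (suc n) (double m)
N-E≡V n k m = trans (N-E-sum (suc n) k (+ m))
  (trans (∑ᴾᴾ-cong (suc n) λ p q → cong 𝟙
    (does-⇔ (mk⇔ (to p q) (from p q)) (onIndex? k (+ 2 ℤ.* + m) p q) (admissible? isEven k p q (double m))))
  (sym (V-coefficient isEven k (suc n) (double m))))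
  where
  to : ∀ (p q : Path (suc n)) → + (#E p ℕ.+ #E q) ≡ + 2 ℤ.* + m × #intersections p q ≡ k →
    (visits +0 p q ≡ suc k × T (isEven ∣ final +0 p q ∣)) × #E p ℕ.+ #E q ≡ double m
  to p q (e , i) = (trans (visits≡1+intersections p q) (cong suc i) , subst T (sym isEven-final) _) , e′
    where
    e′ : #E p ℕ.+ #E q ≡ double m
    e′ = ℤ.+-injective (trans e (+double m))
    isEven-final : isEven ∣ final +0 p q ∣ ≡ true
    isEven-final = trans (cong (λ d → isEven ∣ d ∣) (final₀ p q))
      (trans (isEven-∣⊖∣ (#E p) (#E q)) (trans (cong isEven e′) (isEven-double m)))
  from : ∀ (p q : Path (suc n)) →
    (visits +0 p q ≡ suc k × T (isEven ∣ final +0 p q ∣)) × #E p ℕ.+ #E q ≡ double m →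
    + (#E p ℕ.+ #E q) ≡ + 2 ℤ.* + m × #intersections p q ≡ k
  from p q ((v , _) , e) = trans (cong +_ e) (sym (+double m)) ,
    ℕ.suc-injective (trans (sym (visits≡1+intersections p q)) v)

-- End height 0 makes the two E-counts equal, and their total 2m then makes each of them m.
Nₖ≡V : ∀ n k m → Nₖ (suc n) k (+ m) ≡ V isZero k (suc n) (double m)
Nₖ≡V n k m = trans (M-sum (suc n) k (+ m) (+ m))
  (trans (∑ᴾᴾ-cong (suc n) λ p q → cong 𝟙
    (does-⇔ (mk⇔ (to p q) (from p q)) (counted? (suc n) k (+ m) (+ m) (p , q)) (admissible? isZero k p q (double m))))
  (sym (V-coefficient isZero k (suc n) (double m))))
  where
  to : ∀ (p q : Path (suc n)) → Counted (suc n) k (+ m) (+ m) (p , q) →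
    (visits +0 p q ≡ suc k × T (isZero ∣ final +0 p q ∣)) × #E p ℕ.+ #E q ≡ double m
  to p q (ep , eq , i) = (trans (visits≡1+intersections p q) (cong suc i) , subst T (sym isZero-final) _) ,
    trans (cong₂ ℕ._+_ a b) (sym (double≡ m))
    where
    a : #E p ≡ m
    a = ℤ.+-injective (endpoint⁻ p ep)
    b : #E q ≡ m
    b = ℤ.+-injective (endpoint⁻ q eq)
    isZero-final : isZero ∣ final +0 p q ∣ ≡ true
    isZero-final = cong (λ d → isZero ∣ d ∣)
      (trans (final₀ p q) (trans (cong₂ ℤ._⊖_ a b) (ℤ.n⊖n≡0 m)))
  from : ∀ (p q : Path (suc n)) →
    (visits +0 p q ≡ suc k × T (isZero ∣ final +0 p q ∣)) × #E p ℕ.+ #E q ≡ double m →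
    Counted (suc n) k (+ m) (+ m) (p , q)
  from p q ((v , z) , e) = endpoint⁺ p (cong +_ a) , endpoint⁺ q (cong +_ (trans (sym a≡b) a)) ,
    ℕ.suc-injective (trans (sym (visits≡1+intersections p q)) v)
    where
    a≡b : #E p ≡ #E q
    a≡b = ℤ.+-injective (ℤ.i-j≡0⇒i≡j (+ #E p) (+ #E q)
      (trans (ℤ.[+m]-[+n]≡m⊖n (#E p) (#E q)) (trans (sym (final₀ p q)) (ℤ.∣i∣≡0⇒i≡0 (isZero⁻ z)))))
    a : #E p ≡ m
    a = double-injective (trans (double≡ (#E p)) (trans (cong (#E p ℕ.+_) a≡b) e))

open import Algebra.Definitions.RawMonoid
  (CommutativeSemiring.+-rawMonoid R) using () renaming (_×_ to _×ᴿ_)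

×-coefficient : ∀ n f w → (n ×ᴿ f) w ≡ n ℕ.* f w
×-coefficient zero    f w = refl
×-coefficient (suc n) f w = cong (f w ℕ.+_) (×-coefficient n f w)

-- For p = m ≥ 0 this is the coefficient of X^(2m) in `V-even≈θV-δ`; for negative p both counts
-- vanish, as E-counts are natural numbers.
count-identity : ∀ n k p → suc k ℕ.* N-E (suc n) k p ≡ suc n ℕ.* Nₖ (suc n) k p
count-identity n k (+ m) = begin
  suc k ℕ.* N-E (suc n) k (+ m)                    ≡⟨ cong (suc k ℕ.*_) (N-E≡V n k m) ⟩
  suc k ℕ.* V isEven k (suc n) (double m)          ≡⟨ ×-coefficient (suc k) _ (double m) ⟨
  (suc k ×ᴿ V isEven k (suc n)) (double m)         ≡⟨ V-even≈θV-δ k (suc n) (double m) ⟩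
  (suc n ×ᴿ V isZero k (suc n)) (double m)         ≡⟨ ×-coefficient (suc n) _ (double m) ⟩
  suc n ℕ.* V isZero k (suc n) (double m)          ≡⟨ cong (suc n ℕ.*_) (Nₖ≡V n k m) ⟨
  suc n ℕ.* Nₖ (suc n) k (+ m)                     ∎
  where open ≡-Reasoning
count-identity n k -[1+ m ] = begin
  suc k ℕ.* N-E (suc n) k -[1+ m ]    ≡⟨ cong (suc k ℕ.*_) N-E≡0 ⟩
  suc k ℕ.* 0                         ≡⟨ ℕ.*-zeroʳ (suc k) ⟩
  0                                   ≡⟨ ℕ.*-zeroʳ (suc n) ⟨
  suc n ℕ.* 0                         ≡⟨ cong (suc n ℕ.*_) Nₖ≡0 ⟨
  suc n ℕ.* Nₖ (suc n) k -[1+ m ]     ∎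
  where
  open ≡-Reasoning
  N-E≡0 : N-E (suc n) k -[1+ m ] ≡ 0
  N-E≡0 = trans (N-E-sum (suc n) k -[1+ m ]) (∑ᴾᴾ-0 (suc n) λ p q →
    cong 𝟙 (dec-false (onIndex? k (+ 2 ℤ.* -[1+ m ]) p q) λ ()))
  Nₖ≡0 : Nₖ (suc n) k -[1+ m ] ≡ 0
  Nₖ≡0 = trans (M-sum (suc n) k -[1+ m ] -[1+ m ]) (∑ᴾᴾ-0 (suc n) λ p q →
    cong 𝟙 (dec-false (counted? (suc n) k -[1+ m ] -[1+ m ] (p , q))
      λ (ep , _) → contradiction (endpoint⁻ p ep) λ ()))

-- `_/_` normalises fractions, so the equation is moved to unnormalised rationals, where it is a
-- cross multiplication.
/-identity : ∀ a b n k → suc k ℕ.* a ≡ n ℕ.* b → + a / 1 ≡ (+ n / suc k) * (+ b / 1)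
/-identity a b n k eq = ℚ.toℚᵘ-injective (begin
  toℚᵘ (+ a / 1)                                     ≈⟨ ℚ.toℚᵘ-fromℚᵘ (ℚᵘ.mkℚᵘ (+ a) 0) ⟩
  ℚᵘ.mkℚᵘ (+ a) 0                                    ≈⟨ ℚᵘ.*≡* cross ⟩
  ℚᵘ.mkℚᵘ (+ n) k ℚᵘ.* ℚᵘ.mkℚᵘ (+ b) 0
    ≈⟨ ℚᵘ.*-cong (ℚ.toℚᵘ-fromℚᵘ (ℚᵘ.mkℚᵘ (+ n) k)) (ℚ.toℚᵘ-fromℚᵘ (ℚᵘ.mkℚᵘ (+ b) 0)) ⟨
  toℚᵘ (+ n / suc k) ℚᵘ.* toℚᵘ (+ b / 1)             ≈⟨ ℚ.toℚᵘ-homo-* (+ n / suc k) (+ b / 1) ⟨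
  toℚᵘ ((+ n / suc k) * (+ b / 1))                   ∎)
  where
  open ℚᵘ.≃-Reasoning
  cross : + a ℤ.* + (suc k ℕ.* 1) ≡ + n ℤ.* + b ℤ.* + 1
  cross rewrite ℕ.*-identityʳ k = trans (sym (ℤ.pos-* a (suc k))) (trans (cong +_ (trans (ℕ.*-comm a (suc k)) eq))
    (trans (ℤ.pos-* n b) (sym (ℤ.*-identityʳ _))))

theorem1 : (n k : ℕ) (p : ℤ) → 1 ≤ n →
    + N-E n k p / 1 ≡ (+ n / suc k) * (+ Nₖ n k p / 1)
theorem1 (suc n) k p _ = /-identity (N-E (suc n) k p) (Nₖ (suc n) k p) (suc n) k (count-identity n k p)
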